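{- The class of interval graphs and the class of permutation graphs do not admit low rank-width colorings.
   Context: All graphs are finite and simple. An interval graph is the intersection graph of a family of intervals on the real line. A permutation graph is the intersection graph of line segments whose endpoints lie on two parallel lines. Rank-width: for a graph $G$ and $X\subseteq V(G)$, $\mathrm{cutrk}_G(X)$ is the rank over GF(2) of the adjacency submatrix with rows $X$ and columns $V(G)\setminus X$; a rank-decomposition is a tree with all nodes of degree 1 or 3 whose leaves are in bijection with $V(G)$, an edge $e$ has width $\mathrm{cutrk}_G$ of the vertex set on one side of $e$, and the rank-width is the minimum over rank-decompositions of the maximum edge width ($0$ for graphs with at most one vertex). A class $\mathcal{D}$ of graphs admits low rank-width colorings if there exist functions $N,Q\colon\mathbb{N}\to\mathbb{N}$ such that for all $p\in\mathbb{N}$, every $G\in\mathcal{D}$ can be vertex colored with at most $N(p)$ colors such that the union of any $i\le p$ color classes induces a subgraph of rank-width at most $Q(i)$. -}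

module Defs where

open import Data.Nat using (ℕ; zero; suc; _+_; _≤_)
open import Data.Fin using (Fin; zero; suc; inject₁; fromℕ; _≟_)
open import Data.Bool using (Bool; true; false; _∧_; _∨_; not; _xor_; if_then_else_)
open import Data.Product using (Σ; _×_; _,_)
open import Data.Sum using (_⊎_)
open import Data.Rational as ℚ using (ℚ)
open import Relation.Nullary using (¬_)
open import Relation.Nullary.Decidable using (⌊_⌋)
open import Relation.Binary.PropositionalEquality using (_≡_; _≢_)
open import Function.Definitions using (Injective)

record Graph (n : ℕ) : Set where
  field
    adj    : Fin n → Fin n → Bool
    sym    : ∀ i j → adj i j ≡ adj j i
    irrefl : ∀ i → adj i i ≡ false
open Graph public

countB : ∀ {m} → (Fin m → Bool) → ℕ
countB {zero}  P = 0
countB {suc m} P = (if P zero then 1 else 0) + countB (λ i → P (suc i))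

xorSum : ∀ {m} → (Fin m → Bool) → Bool
xorSum {zero}  f = false
xorSum {suc m} f = f zero xor xorSum (λ i → f (suc i))

IsIntervalGraph : ∀ {n} → Graph n → Set
IsIntervalGraph {n} G =
  Σ (Fin n → ℚ) λ l → Σ (Fin n → ℚ) λ r →
    (∀ i → l i ℚ.≤ r i) ×
    (∀ i j → i ≢ j →
       (adj G i j ≡ true → (l i ℚ.≤ r j × l j ℚ.≤ r i)) ×
       ((l i ℚ.≤ r j × l j ℚ.≤ r i) → adj G i j ≡ true))

-- Permutation graphs: segment i joins the point (a i , 0) to (b i , 1);
-- two such segments intersect iff they are not strictly separated.

SegmentsMeet : ℚ → ℚ → ℚ → ℚ → Set
SegmentsMeet ai bi aj bj =
  ¬ ((ai ℚ.< aj × bi ℚ.< bj) ⊎ (aj ℚ.< ai × bj ℚ.< bi))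

IsPermutationGraph : ∀ {n} → Graph n → Set
IsPermutationGraph {n} G =
  Σ (Fin n → ℚ) λ a → Σ (Fin n → ℚ) λ b →
    (∀ i j → i ≢ j →
       (adj G i j ≡ true → SegmentsMeet (a i) (b i) (a j) (b j)) ×
       (SegmentsMeet (a i) (b i) (a j) (b j) → adj G i j ≡ true))

-- Cut-rank.  For a graph G, a vertex set U (the induced subgraph G[U])
-- and X ⊆ U, the cut-rank is the GF(2)-rank of the adjacency matrix with
-- rows X and columns U ∖ X, i.e. the maximum size of a linearly
-- independent family of rows.  CutRankAtMost says this maximum is ≤ k.

Mem : ∀ {n} → (Fin n → Bool) → Fin n → Set
Mem S v = S v ≡ true

RowsIndependent : ∀ {n m} → Graph n → (U X : Fin n → Bool) → (Fin m → Fin n) → Set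
RowsIndependent {n} {m} G U X f =
  (c : Fin m → Bool) →
  (∀ y → Mem U y → X y ≡ false → xorSum (λ i → c i ∧ adj G (f i) y) ≡ false) →
  ∀ i → c i ≡ false

CutRankAtMost : ∀ {n} → Graph n → (U X : Fin n → Bool) → ℕ → Set
CutRankAtMost {n} G U X k =
  ∀ m (f : Fin m → Fin n) → (∀ i → Mem X (f i)) → RowsIndependent G U X f → m ≤ k

data Walk {m} (E : Fin m → Fin m → Bool) : Fin m → Fin m → Set where
  here : ∀ {s} → Walk E s s
  step : ∀ {s t u} → E s t ≡ true → Walk E t u → Walk E s u

HasCycle : ∀ {m} → (Fin m → Fin m → Bool) → Set
HasCycle {m} E =
  Σ ℕ λ ℓ → Σ (Fin (suc (suc (suc ℓ))) → Fin m) λ c →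
    Injective _≡_ _≡_ c ×
    (∀ (i : Fin (suc (suc ℓ))) → E (c (inject₁ i)) (c (suc i)) ≡ true) ×
    (E (c (fromℕ (suc (suc ℓ)))) (c zero) ≡ true)

record IsTree {m} (E : Fin m → Fin m → Bool) : Set where
  field
    symm      : ∀ i j → E i j ≡ E j i
    irrefl    : ∀ i → E i i ≡ false
    connected : ∀ s t → Walk E s t
    acyclic   : ¬ HasCycle E

degree : ∀ {m} → (Fin m → Fin m → Bool) → Fin m → ℕ
degree E t = countB (E t)

removeEdge : ∀ {m} → (Fin m → Fin m → Bool) → Fin m → Fin m → Fin m → Fin m → Bool
removeEdge E u v a b =
  E a b ∧ not ((⌊ a ≟ u ⌋ ∧ ⌊ b ≟ v ⌋) ∨ (⌊ a ≟ v ⌋ ∧ ⌊ b ≟ u ⌋))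

record RankDecompositionOfWidth {n} (G : Graph n) (U : Fin n → Bool) (k : ℕ) : Set where
  field
    m       : ℕ
    T       : Fin m → Fin m → Bool
    isTree  : IsTree T
    degrees : ∀ t → degree T t ≡ 1 ⊎ degree T t ≡ 3
    leaf    : Fin n → Fin m
    leaf-is-leaf : ∀ v → Mem U v → degree T (leaf v) ≡ 1
    leaf-inj     : ∀ v w → Mem U v → Mem U w → leaf v ≡ leaf w → v ≡ w
    leaf-surj    : ∀ t → degree T t ≡ 1 → Σ (Fin n) λ v → Mem U v × leaf v ≡ t
    side    : Fin m → Fin m → Fin m → Bool
    side-spec : ∀ u v t → (side u v t ≡ true → Walk (removeEdge T u v) u t) ×
                          (Walk (removeEdge T u v) u t → side u v t ≡ true)
    width   : ∀ u v → T u v ≡ true →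
              CutRankAtMost G U (λ x → U x ∧ side u v (leaf x)) k

RankWidthAtMost : ∀ {n} → Graph n → (Fin n → Bool) → ℕ → Set
RankWidthAtMost G U k = countB U ≤ 1 ⊎ RankDecompositionOfWidth G U k

GraphClass : Set₁
GraphClass = ∀ {n} → Graph n → Set

AdmitsLowRankWidthColorings : GraphClass → Set
AdmitsLowRankWidthColorings D =
  Σ (ℕ → ℕ) λ N → Σ (ℕ → ℕ) λ Q →
    ∀ (p : ℕ) {n} (G : Graph n) → D G →
      Σ (Fin n → Fin (N p)) λ col →
        ∀ (i : ℕ) → i ≤ p →
        ∀ (S : Fin (N p) → Bool) → countB S ≡ i →
          RankWidthAtMost G (λ v → S (col v)) (Q i)

{-# OPTIONS --safe #-}
-- A single colour class already has large rank-width, for a suitable host graph.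
-- The host has the pairs from Fin M as vertices, read as intervals or as segments of a
-- permutation diagram. Ramsey's theorem for pairs yields a large H ⊆ Fin M all of whose
-- increasing pairs get one colour, and those pairs contain a twisted chain graph: a grid c i j
-- together with probes a x and b y such that a x ~ c i j iff x ≤ i, and b y ~ c i j iff y ≤ j.
-- In a cut of cut-rank k at most 2k rows and 2k columns of the grid meet both sides, because
-- mixed rows, with the probes on the majority side, give a triangular submatrix. So one side of
-- every edge of the decomposition is heavy (it contains almost all rows and columns), and
-- following the heavy sides down the tree ends at a vertex that would carry two grid vertices.

module Submission where

open import Defs hiding (sym; irrefl)
open import Data.Bool as Bool using (Bool; true; false; _∧_; _∨_; not; _xor_)
open import Data.Bool.Properties using (¬-not; not-involutive; ∧-zeroʳ; ∧-identityʳ; xor-identityʳ)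
open import Data.Empty using (⊥; ⊥-elim)
open import Data.Fin as Fin
  using (Fin; zero; suc; toℕ; fromℕ; inject₁; inject≤; _≟_; _↑ˡ_; _↑ʳ_; combine; remQuot; opposite)
open import Data.Fin.Properties as Fin
  using (all?; any?; ¬∀⟶∃¬; suc-injective; toℕ<n; toℕ-injective; toℕ-inject≤; toℕ-↑ˡ; toℕ-↑ʳ;
         remQuot-combine; combine-injective; opposite-prop; opposite-involutive)
open import Data.Integer as ℤ using (+_; +≤+; +<+)
open import Data.Integer.Properties using (drop‿+≤+; drop‿+<+; *-identityʳ)
open import Data.List using (List; []; _∷_; length; map; filter; allFin; lookup)
open import Data.List.Membership.Propositional using (_∈_)
open import Data.List.Membership.Propositional.Properties using (∈-allFin; ∈-lookup)
open import Data.List.Properties using (length-map; length-tabulate)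
open import Data.List.Relation.Binary.Sublist.Propositional using (_⊆_; []; _∷_; _∷ʳ_; ⊆-trans; minimum)
open import Data.List.Relation.Binary.Sublist.Propositional.Properties using (All-resp-⊆; filter-⊆; map⁺)
open import Data.List.Relation.Unary.All as All using (All; []; _∷_)
open import Data.List.Relation.Unary.All.Properties as All using (all-filter)
open import Data.List.Relation.Unary.AllPairs as AllPairs using (AllPairs; []; _∷_)
open import Data.List.Relation.Unary.AllPairs.Properties as AllPairs using (tabulate⁺-<)
open import Data.List.Relation.Unary.Any using (here; there)
open import Data.Nat as ℕ using (ℕ; zero; suc; _+_; _*_; _≤_; _<_; z≤n; s≤s; s≤s⁻¹; _≤?_; _<?_; _⊔_)
open import Data.Nat.Coprimality using (1-coprimeTo) renaming (sym to coprime-sym)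
open import Data.Nat.Properties hiding (suc-injective; _≟_; *-identityʳ)
open import Data.Product using (Σ; ∃; _×_; _,_; proj₁; proj₂)
open import Data.Rational as ℚ using (ℚ; mkℚ; *≤*; *<*)
open import Data.Rational.Properties using (drop-*≤*; drop-*<*)
open import Data.Sum as Sum using (_⊎_; inj₁; inj₂; [_,_]′; swap)
open import Function using (_∘_; id; flip; _⇔_; mk⇔)
open import Function.Definitions using (Injective)
open import Relation.Binary.Definitions using (DecidableEquality)
open import Relation.Binary.PropositionalEquality
open import Relation.Nullary using (¬_; Dec; yes; no; does)
open import Relation.Nullary.Decidable using (dec-true; dec-false; does-⇔; ¬?; _×-dec_; _⊎-dec_)
open import Relation.Unary using (Decidable)

-- Pigeonhole and Ramsey's theorem for pairs

private variable
  A B : Set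

length-filter-¬ : {P : A → Set} (P? : Decidable P) (xs : List A) →
  length (filter P? xs) + length (filter (¬? ∘ P?) xs) ≡ length xs
length-filter-¬ P? [] = refl
length-filter-¬ P? (x ∷ xs) with P? x
... | yes _ = cong suc (length-filter-¬ P? xs)
... | no  _ = trans (+-suc _ _) (cong suc (length-filter-¬ P? xs))

module _ (_≟_ : DecidableEquality B) (f : A → B) (m : ℕ) where

  -- Either the class of `c` is long, or discarding it costs at most `m` elements and the remaining
  -- colours still overflow. Returning a sublist preserves the order that Ramsey needs.
  pigeonhole : ∀ cs xs → All (λ x → f x ∈ cs) xs → length cs * m < length xs →
    ∃ λ c → ∃ λ ys → ys ⊆ xs × All (λ x → f x ≡ c) ys × m < length ys
  pigeonhole [] (x ∷ xs) (() ∷ _) _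
  pigeonhole (c ∷ cs) xs all∈ big with suc m ≤? length (filter (λ x → f x ≟ c) xs)
  ... | yes many = c , _ , filter-⊆ _ xs , all-filter _ xs , many
  ... | no few with pigeonhole cs rest rest∈ restBig
    where
    rest = filter (λ x → ¬? (f x ≟ c)) xs

    drop-head : ∀ {y} → y ∈ c ∷ cs → ¬ y ≡ c → y ∈ cs
    drop-head (here eq) neq = ⊥-elim (neq eq)
    drop-head (there y∈cs) _ = y∈cs

    rest∈ : All (λ x → f x ∈ cs) rest
    rest∈ = All.zipWith (λ (p , q) → drop-head p q)
              (All-resp-⊆ (filter-⊆ _ xs) all∈ , all-filter _ xs)

    restBig : length cs * m < length rest
    restBig = +-cancelˡ-< m _ _ (<-≤-trans big
      (subst (_≤ m + length rest) (length-filter-¬ (λ x → f x ≟ c) xs)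
        (+-monoˡ-≤ (length rest) (≮⇒≥ few))))
  ...   | d , ys , ys⊆ , mono , long = d , ys , ⊆-trans ys⊆ (filter-⊆ _ xs) , mono , long

AllPairs-resp-⊆ : ∀ {R : A → A → Set} {xs ys} → xs ⊆ ys → AllPairs R ys → AllPairs R xs
AllPairs-resp-⊆ [] [] = []
AllPairs-resp-⊆ (_ ∷ʳ p) (_ ∷ rs) = AllPairs-resp-⊆ p rs
AllPairs-resp-⊆ (refl ∷ p) (r ∷ rs) = All-resp-⊆ p r ∷ AllPairs-resp-⊆ p rs

AllPairs-lookup : ∀ {R : A → A → Set} {xs} → AllPairs R xs →
  ∀ i j → i Fin.< j → R (lookup xs i) (lookup xs j)
AllPairs-lookup (r ∷ _)  zero    (suc j) _ = All.lookup r (∈-lookup j)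
AllPairs-lookup (_ ∷ rs) (suc i) (suc j) i<j = AllPairs-lookup rs i j (s≤s⁻¹ i<j)

module _ {N : ℕ} where

  pigeonholeFin : (f : A → Fin N) (m : ℕ) (xs : List A) → N * m < length xs →
    ∃ λ c → ∃ λ ys → ys ⊆ xs × All (λ x → f x ≡ c) ys × m < length ys
  pigeonholeFin f m xs big = pigeonhole _≟_ f m (allFin N) xs
    (All.universal (λ x → ∈-allFin (f x)) xs)
    (subst (λ l → l * m < length xs) (sym (length-tabulate {n = N} id)) big)

  -- Of the `2`, one counts the element kept in a round and one makes the pigeonhole inequality
  -- strict.
  endBound : ℕ → ℕ
  endBound zero    = 0
  endBound (suc ℓ) = 2 + N * endBound ℓ

  module _ (χ : A → A → Fin N) where

    -- In a surviving pair (x , c), c is the colour of every pair from x to a later element.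
    endHomogeneous : ∀ ℓ xs → endBound ℓ ≤ length xs → Σ (List (A × Fin N)) λ ys →
      map proj₁ ys ⊆ xs × ℓ ≤ length ys × AllPairs (λ p q → χ (proj₁ p) (proj₁ q) ≡ proj₂ p) ys
    endHomogeneous zero xs _ = [] , minimum xs , z≤n , []
    endHomogeneous (suc ℓ) (x ∷ xs) (s≤s big)
      with pigeonholeFin (χ x) (endBound ℓ) xs big
    ... | c , zs , zs⊆ , mono , long with endHomogeneous ℓ zs (<⇒≤ long)
    ...   | ys , ys⊆ , long′ , pairs =
      (x , c) ∷ ys , refl ∷ ⊆-trans ys⊆ zs⊆ , s≤s long′ ,
      All.map⁻ (All-resp-⊆ ys⊆ mono) ∷ pairs

  ramseyBound : ℕ → ℕ
  ramseyBound L = endBound (suc (N * L))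

  -- Among the survivors the colour of a pair depends only on its earlier element, so one pigeonhole
  -- on the recorded colours makes it constant.
  ramsey-list : (χ : A → A → Fin N) → ∀ L xs → ramseyBound L ≤ length xs →
    ∃ λ c → ∃ λ ys → ys ⊆ xs × L ≤ length ys × AllPairs (λ x y → χ x y ≡ c) ys
  ramsey-list χ L xs big with endHomogeneous χ (suc (N * L)) xs big
  ... | ys , ys⊆ , long , pairs with pigeonholeFin proj₂ L ys long
  ...   | c , zs , zs⊆ , mono , long′ =
    c , map proj₁ zs , ⊆-trans (map⁺ proj₁ zs⊆) ys⊆ ,
    subst (L ≤_) (sym (length-map proj₁ zs)) (<⇒≤ long′) ,
    AllPairs.map⁺ (uniform mono (AllPairs-resp-⊆ zs⊆ pairs))
    where
    uniform : ∀ {zs} → All (λ p → proj₂ p ≡ c) zs →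
      AllPairs (λ p q → χ (proj₁ p) (proj₁ q) ≡ proj₂ p) zs →
      AllPairs (λ p q → χ (proj₁ p) (proj₁ q) ≡ c) zs
    uniform [] [] = []
    uniform (eq ∷ eqs) (r ∷ rs) = All.map (λ e → trans e eq) r ∷ uniform eqs rs

  ramsey : ∀ L → let M = ramseyBound L in (χ : Fin M → Fin M → Fin N) →
    ∃ λ c → Σ (Fin L → Fin M) λ h →
      ∀ {i j} → i Fin.< j → h i Fin.< h j × χ (h i) (h j) ≡ c
  ramsey L χ with ramsey-list χ L (allFin (ramseyBound L)) (≤-reflexive (sym (length-tabulate id)))
  ... | c , ys , ys⊆ , long , pairs = c , h , λ {i} {j} i<j →
    AllPairs-lookup
      {R = λ x y → x Fin.< y × χ x y ≡ c}
      -- `allFin` is increasing, hence so is each of its sublists.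
      (AllPairs.zip (AllPairs-resp-⊆ ys⊆ (tabulate⁺-< {f = id} id) , pairs)) _ _
      (subst₂ _<_ (sym (toℕ-inject≤ i long)) (sym (toℕ-inject≤ j long)) i<j)
    where
    h : Fin L → Fin (ramseyBound L)
    h i = lookup ys (inject≤ i long)

-- Boolean facts and counting in finite sets

does⇒ : {A : Set} (a? : Dec A) → does a? ≡ true → A
does⇒ (yes a) _ = a

does⇒¬ : {A : Set} (a? : Dec A) → does a? ≡ false → ¬ A
does⇒¬ (no ¬a) _ = ¬a

false≢true : false ≢ true
false≢true ()

∧-trueˡ : ∀ {x y} → x ∧ y ≡ true → x ≡ true
∧-trueˡ {true} _ = refl

∧-trueʳ : ∀ {x y} → x ∧ y ≡ true → y ≡ true
∧-trueʳ {true} eq = eq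

∨-falseˡ : ∀ {x y} → x ∨ y ≡ false → x ≡ false
∨-falseˡ {false} _ = refl

∨-falseʳ : ∀ x {y} → x ∨ y ≡ false → y ≡ false
∨-falseʳ false eq = eq

countB-split : ∀ {n} (P Q : Fin n → Bool) →
  countB P ≡ countB (λ i → P i ∧ Q i) + countB (λ i → P i ∧ not (Q i))
countB-split {zero}  P Q = refl
countB-split {suc n} P Q with P zero | Q zero | countB-split (P ∘ suc) (Q ∘ suc)
... | false | _     | ih = ih
... | true  | true  | ih = cong suc ih
... | true  | false | ih = trans (cong suc ih) (sym (+-suc _ _))

countB-mono : ∀ {n} (P Q : Fin n → Bool) → (∀ i → P i ≡ true → Q i ≡ true) → countB P ≤ countB Q
countB-mono {zero}  P Q imp = z≤n
countB-mono {suc n} P Q imp with P zero in p | Q zero in q | countB-mono (P ∘ suc) (Q ∘ suc) (imp ∘ suc)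
... | false | false | ih = ih
... | false | true  | ih = m≤n⇒m≤1+n ih
... | true  | true  | ih = s≤s ih
... | true  | false | ih with () ← trans (sym q) (imp zero p)

countB-mono-< : ∀ {n} (P Q : Fin n → Bool) → (∀ i → P i ≡ true → Q i ≡ true) →
  ∀ i → P i ≡ false → Q i ≡ true → countB P < countB Q
countB-mono-< P Q imp zero p q rewrite p | q = s≤s (countB-mono (P ∘ suc) (Q ∘ suc) (imp ∘ suc))
countB-mono-< P Q imp (suc i) p q with P zero in p₀ | Q zero in q₀ | countB-mono-< (P ∘ suc) (Q ∘ suc) (imp ∘ suc) i p q
... | false | false | ih = ih
... | false | true  | ih = m≤n⇒m≤1+n ih
... | true  | true  | ih = s≤s ih
... | true  | false | ih with () ← trans (sym q₀) (imp zero p₀)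

countB-∨ : ∀ {n} (P Q : Fin n → Bool) → countB (λ i → P i ∨ Q i) ≤ countB P + countB Q
countB-∨ {zero}  P Q = z≤n
countB-∨ {suc n} P Q with P zero | Q zero | countB-∨ (P ∘ suc) (Q ∘ suc)
... | false | false | ih = ih
... | false | true  | ih = ≤-trans (s≤s ih) (≤-reflexive (sym (+-suc _ _)))
... | true  | false | ih = s≤s ih
... | true  | true  | ih = s≤s (≤-trans ih (+-monoʳ-≤ _ (n≤1+n _)))

countB<⇒∃false : ∀ {n} (P : Fin n → Bool) → countB P < n → ∃ λ i → P i ≡ false
countB<⇒∃false {suc n} P lt with P zero in p
... | false = zero , p
... | true with countB<⇒∃false (P ∘ suc) (s≤s⁻¹ lt)
...   | i , q = suc i , q

countB-false : ∀ n → countB {n} (λ _ → false) ≡ 0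
countB-false zero    = refl
countB-false (suc n) = countB-false n

countB-single : ∀ {n} (i : Fin n) → countB (λ j → does (j ≟ i)) ≡ 1
countB-single {suc n} zero = cong suc (countB-false n)
countB-single (suc i) = countB-single i

-- The increasing order is what later makes the submatrices of a cut triangular.
enumerate : ∀ {n} (P : Fin n → Bool) {k} → k ≤ countB P →
  Σ (Fin k → Fin n) λ e → (∀ i → P (e i) ≡ true) × (∀ {i j} → i Fin.< j → e i Fin.< e j)
enumerate {n} P {zero} _ = (λ ()) , (λ ()) , λ { {()} }
enumerate {suc n} P {suc k} le with P zero in p
... | false with enumerate (P ∘ suc) le
...   | e , hit , mono = suc ∘ e , hit , s≤s ∘ mono
enumerate {suc n} P {suc k} le | true with enumerate (P ∘ suc) (s≤s⁻¹ le)
...   | e , hit , mono = e′ , hit′ , mono′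
  where
  e′ : Fin (suc k) → Fin (suc n)
  e′ zero    = zero
  e′ (suc i) = suc (e i)
  hit′ : ∀ i → P (e′ i) ≡ true
  hit′ zero    = p
  hit′ (suc i) = hit i
  mono′ : ∀ {i j} → i Fin.< j → e′ i Fin.< e′ j
  mono′ {zero}  {suc j} _  = s≤s z≤n
  mono′ {suc i} {suc j} lt = s≤s (mono (s≤s⁻¹ lt))

countB≤1⇒unique : ∀ {n} (P : Fin n → Bool) → countB P ≤ 1 → ∀ i j → P i ≡ true → P j ≡ true → i ≡ j
countB≤1⇒unique P le i j p q with i ≟ j
... | yes eq = eq
... | no neq = ⊥-elim (<⇒≱ (<-≤-trans one<P le) (≤-reflexive (sym (countB-single i))))
  where
  one<P : countB (λ k → does (k ≟ i)) < countB P
  one<P = countB-mono-< _ P sub j (dec-false (j ≟ i) (neq ∘ sym)) q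
    where
    sub : ∀ k → does (k ≟ i) ≡ true → P k ≡ true
    sub k eq with k ≟ i
    ... | yes refl = p

-- Independence of triangular matrices over GF(2)

xorSum-false : ∀ {n} {f : Fin n → Bool} → (∀ i → f i ≡ false) → xorSum f ≡ false
xorSum-false {zero}  eq = refl
xorSum-false {suc n} eq = cong₂ _xor_ (eq zero) (xorSum-false (eq ∘ suc))

-- Column `zero` has its only nonzero entry in row `zero`, so it forces `c zero` to vanish; the rest
-- is induction on the minor.
upper-triangular-independent : ∀ {n} (M : Fin n → Fin n → Bool) →
  (∀ i → M i i ≡ true) → (∀ i j → j Fin.< i → M i j ≡ false) →
  (c : Fin n → Bool) → (∀ j → xorSum (λ i → c i ∧ M i j) ≡ false) → ∀ i → c i ≡ false
upper-triangular-independent {suc n} M diag below c sums = result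
  where
  open ≡-Reasoning
  c₀ : c zero ≡ false
  c₀ = begin
    c zero                                    ≡⟨ xor-identityʳ _ ⟨
    c zero xor false                          ≡⟨ cong₂ _xor_ (trans (cong (c zero ∧_) (diag zero)) (∧-identityʳ _))
                                                   (xorSum-false λ i → trans (cong (c (suc i) ∧_) (below (suc i) zero (s≤s z≤n))) (∧-zeroʳ _)) ⟨
    xorSum (λ i → c i ∧ M i zero)             ≡⟨ sums zero ⟩
    false                                     ∎
  tail-sums : ∀ j → xorSum (λ i → c (suc i) ∧ M (suc i) (suc j)) ≡ false
  tail-sums j = trans (cong (λ b → (b ∧ M zero (suc j)) xor xorSum (λ i → c (suc i) ∧ M (suc i) (suc j))) (sym c₀))
                      (sums (suc j))
  result : ∀ i → c i ≡ false
  result zero    = c₀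
  result (suc i) = upper-triangular-independent (λ i j → M (suc i) (suc j)) (diag ∘ suc)
    (λ i j lt → below (suc i) (suc j) (s≤s lt)) (c ∘ suc) tail-sums i

-- Here row `zero` vanishes beyond column `zero`, so the induction on the minor comes first and
-- column `zero` is read last.
lower-triangular-independent : ∀ {n} (M : Fin n → Fin n → Bool) →
  (∀ i → M i i ≡ true) → (∀ i j → i Fin.< j → M i j ≡ false) →
  (c : Fin n → Bool) → (∀ j → xorSum (λ i → c i ∧ M i j) ≡ false) → ∀ i → c i ≡ false
lower-triangular-independent {suc n} M diag above c sums = result
  where
  open ≡-Reasoning
  tail-sums : ∀ j → xorSum (λ i → c (suc i) ∧ M (suc i) (suc j)) ≡ false
  tail-sums j = trans (cong (_xor xorSum (λ i → c (suc i) ∧ M (suc i) (suc j)))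
      (sym (trans (cong (c zero ∧_) (above zero (suc j) (s≤s z≤n))) (∧-zeroʳ _))))
    (sums (suc j))
  ctail : ∀ i → c (suc i) ≡ false
  ctail = lower-triangular-independent (λ i j → M (suc i) (suc j)) (diag ∘ suc)
    (λ i j lt → above (suc i) (suc j) (s≤s lt)) (c ∘ suc) tail-sums
  result : ∀ i → c i ≡ false
  result (suc i) = ctail i
  result zero = begin
    c zero                        ≡⟨ xor-identityʳ _ ⟨
    c zero xor false              ≡⟨ cong₂ _xor_ (trans (cong (c zero ∧_) (diag zero)) (∧-identityʳ _))
                                       (xorSum-false λ i → cong (_∧ M (suc i) zero) (ctail i)) ⟨
    xorSum (λ i → c i ∧ M i zero) ≡⟨ sums zero ⟩
    false                         ∎

-- Mixed rows and cut-rank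

module _ {n : ℕ} (Q : Fin n → Fin n → Bool) where

  constant? : ∀ i → Dec (∀ j j′ → Q i j ≡ Q i j′)
  constant? i = all? λ j → all? λ j′ → Q i j Bool.≟ Q i j′

  -- `Q` will tell on which side of a cut each grid vertex lies; columns are treated through
  -- `flip Q`.
  mixed : Fin n → Bool
  mixed i = not (does (constant? i))

  unmixed⇒constant : ∀ {i} → mixed i ≡ false → ∀ j j′ → Q i j ≡ Q i j′
  unmixed⇒constant {i} eq = does⇒ (constant? i) (trans (sym (not-involutive _)) (cong not eq))

  -- Non-constancy gives two columns with different values, and one of two different booleans is
  -- `b`.
  mixed⇒both : ∀ i → mixed i ≡ true → ∀ b → ∃ λ j → Q i j ≡ b
  mixed⇒both i eq b with ¬∀⟶∃¬ n _ (λ j → all? λ j′ → Q i j Bool.≟ Q i j′) ¬const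
    where
    ¬const : ¬ (∀ j j′ → Q i j ≡ Q i j′)
    ¬const = does⇒¬ (constant? i) (trans (sym (not-involutive _)) (cong not eq))
  ... | j , ¬const′ with ¬∀⟶∃¬ n _ (λ j′ → Q i j Bool.≟ Q i j′) ¬const′
  ...   | j′ , neq with Q i j Bool.≟ b
  ...     | yes eq′ = j , eq′
  ...     | no neq′ = j′ , trans (¬-not (neq ∘ sym)) (trans (cong not (¬-not neq′)) (not-involutive b))

-- A half graph between probes and rows. The adjacency ignores `j`, so any vertex of a row may
-- represent it in a cut matrix.
RowProbes : ∀ {N n} → Graph N → (Fin N → Bool) → (Fin n → Fin N) → (Fin n → Fin n → Fin N) → Set
RowProbes G U a c =
  (∀ x → Mem U (a x)) × (∀ i j → Mem U (c i j)) × (∀ x i j → adj G (a x) (c i j) ≡ does (x Fin.≤? i))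

module _ {N n} (G : Graph N) (U X : Fin N → Bool) (a : Fin n → Fin N) (c : Fin n → Fin n → Fin N)
  (probes : RowProbes G U a c) {k} (rank : CutRankAtMost G U X k) where

  private
    Q : Fin n → Fin n → Bool
    Q i j = X (c i j)
    a∈U = proj₁ probes
    c∈U = proj₁ (proj₂ probes)
    a~c = proj₂ (proj₂ probes)

  -- The probes in `X` index the rows of the matrix, and each mixed row of the grid supplies a
  -- column outside `X`. Adjacency is the order of the indices, hence triangular.
  inside≤rank : countB (λ i → mixed Q i ∧ X (a i)) ≤ k
  inside≤rank with enumerate (λ i → mixed Q i ∧ X (a i)) ≤-refl
  ... | e , hit , mono = rank _ (a ∘ e) (λ i → ∧-trueʳ (hit i)) λ w sums →
    upper-triangular-independent (λ i i′ → adj G (a (e i)) (column i′))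
      (λ i → trans (a~c _ _ _) (dec-true (e i Fin.≤? e i) ≤-refl))
      (λ i j lt → trans (a~c _ _ _) (dec-false (e i Fin.≤? e j) (<⇒≱ (mono lt))))
      w (λ i → sums (column i) (c∈U _ _) (proj₂ (outside i)))
    where
    outside : ∀ i → ∃ λ j → Q (e i) j ≡ false
    outside i = mixed⇒both Q (e i) (∧-trueˡ (hit i)) false
    column : ∀ i → Fin N
    column i = c (e i) (proj₁ (outside i))

  -- The roles are exchanged: probes outside `X` become columns and grid vertices inside `X` become
  -- rows, so the matrix is transposed to a lower triangular one.
  outside≤rank : countB (λ i → mixed Q i ∧ not (X (a i))) ≤ k
  outside≤rank with enumerate (λ i → mixed Q i ∧ not (X (a i))) ≤-refl
  ... | e , hit , mono = rank _ row (proj₂ ∘ inside) λ w sums →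
    lower-triangular-independent (λ i i′ → adj G (row i) (a (e i′)))
      (λ i → trans (Graph.sym G _ _) (trans (a~c _ _ _) (dec-true (e i Fin.≤? e i) ≤-refl)))
      (λ i j lt → trans (Graph.sym G _ _) (trans (a~c _ _ _) (dec-false (e j Fin.≤? e i) (<⇒≱ (mono lt)))))
      w (λ i → sums (a (e i)) (a∈U _) (notin (hit i)))
    where
    notin : ∀ {x y} → x ∧ not y ≡ true → y ≡ false
    notin {true} {false} eq = refl
    inside : ∀ i → ∃ λ j → Q (e i) j ≡ true
    inside i = mixed⇒both Q (e i) (∧-trueˡ (hit i)) true
    row : ∀ i → Fin N
    row i = c (e i) (proj₁ (inside i))

  mixed≤2*rank : countB (mixed Q) ≤ k + k
  mixed≤2*rank = ≤-trans (≤-reflexive (countB-split (mixed Q) (X ∘ a))) (+-mono-≤ inside≤rank outside≤rank)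

-- A union bound, used to find one row that is unmixed for all edges at a tree vertex
-- simultaneously.
countB-⋃ : ∀ {m n} (P : Fin m → Bool) (B : Fin m → Fin n → Bool) K →
  (∀ x → P x ≡ true → countB (B x) ≤ K) →
  ∃ λ C → countB C ≤ countB P * K × (∀ i → C i ≡ false → ∀ x → P x ≡ true → B x i ≡ false)
countB-⋃ {zero} {n} P B K small = (λ _ → false) , ≤-reflexive (countB-false n) , λ _ _ ()
countB-⋃ {suc m} P B K small with P zero in p | countB-⋃ (P ∘ suc) (B ∘ suc) K (small ∘ suc)
... | false | C , le , miss = C , le , λ
  { i eq zero q → ⊥-elim (false≢true (trans (sym p) q)) ; i eq (suc x) q → miss i eq x q }
... | true | C , le , miss =
  (λ i → B zero i ∨ C i) , ≤-trans (countB-∨ (B zero) C) (+-mono-≤ (small zero p) le) , λ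
  { i eq zero    q → ∨-falseˡ eq
  ; i eq (suc x) q → miss i (∨-falseʳ (B zero i) eq) x q }

-- Walks, paths and branches of a tree

-- The format is that of `HasCycle`, so that one closing edge turns a long enough path into a cycle.
Path : ∀ {m} → (Fin m → Fin m → Bool) → Fin m → Fin m → ℕ → Set
Path {m} E s t ℓ = Σ (Fin (suc ℓ) → Fin m) λ p →
  Injective _≡_ _≡_ p × p zero ≡ s × p (fromℕ ℓ) ≡ t × (∀ i → E (p (inject₁ i)) (p (suc i)) ≡ true)

module _ {m} (E : Fin m → Fin m → Bool) where

  -- Vertex deletion is encoded as deletion of all edges at `t`, which keeps the vertex type.
  avoid : Fin m → Fin m → Fin m → Bool
  avoid t a b = E a b ∧ (not (does (a ≟ t)) ∧ not (does (b ≟ t)))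

  avoid-intro : ∀ {t a b} → E a b ≡ true → a ≢ t → b ≢ t → avoid t a b ≡ true
  avoid-intro {t} {a} {b} e a≢t b≢t with a ≟ t | b ≟ t
  ... | yes eq | _      = ⊥-elim (a≢t eq)
  ... | no _   | yes eq = ⊥-elim (b≢t eq)
  ... | no _   | no _   = trans (cong (_∧ true) e) refl

  avoid-elim : ∀ {t a b} → avoid t a b ≡ true → E a b ≡ true × a ≢ t × b ≢ t
  avoid-elim {t} {a} {b} e with E a b | a ≟ t | b ≟ t
  ... | true | no a≢t | no b≢t = refl , a≢t , b≢t

  removeEdge-elim : ∀ {u v a b} → removeEdge E u v a b ≡ true →
    E a b ≡ true × ¬ (a ≡ u × b ≡ v) × ¬ (a ≡ v × b ≡ u)
  removeEdge-elim {u} {v} {a} {b} e with E a b | a ≟ u | b ≟ v | a ≟ v | b ≟ u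
  ... | true | no n₁ | _ | no n₂ | _ = refl , n₁ ∘ proj₁ , n₂ ∘ proj₁
  ... | true | no n₁ | _ | yes _ | no n₂ = refl , n₁ ∘ proj₁ , n₂ ∘ proj₂
  ... | true | yes _ | no n₁ | no n₂ | _ = refl , n₁ ∘ proj₂ , n₂ ∘ proj₁
  ... | true | yes _ | no n₁ | yes _ | no n₂ = refl , n₁ ∘ proj₂ , n₂ ∘ proj₂

  removeEdge-intro : ∀ {u v a b} → E a b ≡ true → ¬ (a ≡ u × b ≡ v) → ¬ (a ≡ v × b ≡ u) →
    removeEdge E u v a b ≡ true
  removeEdge-intro {u} {v} {a} {b} e n₁ n₂ with a ≟ u | b ≟ v | a ≟ v | b ≟ u
  ... | yes p | yes q | _ | _ = ⊥-elim (n₁ (p , q))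
  ... | _ | _ | yes p | yes q = ⊥-elim (n₂ (p , q))
  ... | no _ | _ | no _ | _ rewrite e = refl
  ... | no _ | _ | yes _ | no _ rewrite e = refl
  ... | yes _ | no _ | no _ | _ rewrite e = refl
  ... | yes _ | no _ | yes _ | no _ rewrite e = refl

module _ {m} {E : Fin m → Fin m → Bool} where

  suffix : ∀ {s t ℓ} (path : Path E s t ℓ) i → ∃ (Path E (proj₁ path i) t)
  suffix {ℓ = ℓ} (p , inj , start , end , edges) zero = ℓ , p , inj , refl , end , edges
  suffix {ℓ = suc ℓ} (p , inj , start , end , edges) (suc i) =
    suffix (p ∘ suc , suc-injective ∘ inj , refl , end , edges ∘ suc) i

  -- Loop erasure: if `s` already occurs on the path of the tail, the path is cut back to that
  -- occurrence.
  walk⇒path : ∀ {s t} → Walk E s t → ∃ (Path E s t)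
  walk⇒path {s} here = 0 , (λ _ → s) , (λ { {zero} {zero} _ → refl }) , refl , refl , λ ()
  walk⇒path (step {s} {q} {t} e w) with walk⇒path w
  ... | ℓ , path@(p , inj , start , end , edges) with any? (λ i → p i ≟ s)
  ...   | yes (i , eq) = subst (λ r → ∃ (Path E r t)) eq (suffix path i)
  ...   | no fresh = suc ℓ , p′ , inj′ , refl , end , edges′
    where
    p′ : Fin (suc (suc ℓ)) → Fin m
    p′ zero    = s
    p′ (suc i) = p i
    inj′ : Injective _≡_ _≡_ p′
    inj′ {zero}  {zero}  _  = refl
    inj′ {zero}  {suc j} eq = ⊥-elim (fresh (j , sym eq))
    inj′ {suc i} {zero}  eq = ⊥-elim (fresh (i , eq))
    inj′ {suc i} {suc j} eq = cong suc (inj eq)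
    edges′ : ∀ i → E (p′ (inject₁ i)) (p′ (suc i)) ≡ true
    edges′ zero    = subst (λ r → E s r ≡ true) (sym start) e
    edges′ (suc i) = edges i

  walk-map : ∀ {E′ : Fin m → Fin m → Bool} → (∀ a b → E a b ≡ true → E′ a b ≡ true) →
    ∀ {s t} → Walk E s t → Walk E′ s t
  walk-map f here       = here
  walk-map f (step e w) = step (f _ _ e) (walk-map f w)

  unreachable⇒avoid : ∀ {s z t} → (∀ {q} → Walk E s q → q ≢ t) → Walk E s z → Walk (avoid E t) s z
  unreachable⇒avoid un here       = here
  unreachable⇒avoid un (step e w) =
    step (avoid-intro E e (un here) (un (step e here))) (unreachable⇒avoid (un ∘ step e) w)

  -- The tail of the walk is examined before its head, so an occurrence of `t` followed by a walk
  -- avoiding `t` is the last one.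
  last-visit : ∀ {s z} t → Walk E s z →
    z ≡ t ⊎ s ≢ t × Walk (avoid E t) s z ⊎ (∃ λ x → E t x ≡ true × Walk (avoid E t) x z)
  last-visit {s} t here with s ≟ t
  ... | yes eq = inj₁ eq
  ... | no neq = inj₂ (inj₁ (neq , here))
  last-visit t (step {s} {q} e w) with last-visit t w
  ... | inj₁ eq = inj₁ eq
  ... | inj₂ (inj₂ found) = inj₂ (inj₂ found)
  ... | inj₂ (inj₁ (q≢t , w′)) with s ≟ t
  ...   | yes refl = inj₂ (inj₂ (q , e , w′))
  ...   | no s≢t = inj₂ (inj₁ (s≢t , step (avoid-intro E e s≢t q≢t) w′))

module _ {m} {T : Fin m → Fin m → Bool} (tree : IsTree T) where
  open IsTree tree

  -- The component of `t` once the edge to `s` is deleted; `side t s` decides it.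
  Branch : Fin m → Fin m → Fin m → Set
  Branch t s z = Walk (removeEdge T t s) t z

  -- A path from `x` to `t` of length 0 would make the edge a loop, length 1 is the deleted edge,
  -- and any longer path closes to a cycle.
  root∉branch : ∀ {x t} → T x t ≡ true → ¬ Branch x t t
  root∉branch {x} {t} e w with walk⇒path w
  ... | 0 , p , inj , start , end , edges = false≢true (trans (sym (irrefl x))
    (subst (λ r → T x r ≡ true) (trans (sym end) start) e))
  ... | 1 , p , inj , start , end , edges =
    proj₁ (proj₂ (removeEdge-elim T (edges zero))) (start , end)
  ... | suc (suc ℓ) , p , inj , start , end , edges = acyclic
    (ℓ , p , inj , (λ i → proj₁ (removeEdge-elim T (edges i))) ,
     subst₂ (λ a b → T a b ≡ true) (sym end) (sym start) (trans (symm t x) e))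

  -- Edges of `avoid E t` do not touch `t`, hence differ from the deleted one. `E` is general
  -- because both `T` and `T` minus an edge occur.
  avoid⇒branch : ∀ E {x t z} → (∀ {a b} → E a b ≡ true → T a b ≡ true) →
    Walk (avoid E t) x z → Branch x t z
  avoid⇒branch E E⊆T = walk-map λ a b e → let (e′ , a≢t , b≢t) = avoid-elim E e in
    removeEdge-intro T (E⊆T e′) (b≢t ∘ proj₂) (a≢t ∘ proj₁)

  -- After its last visit to `t` the walk enters a neighbour `x`, which is not `s` because that edge
  -- is gone.
  branch-split : ∀ {t s z} → Branch t s z → z ≡ t ⊎ ∃ λ x → T t x ≡ true × x ≢ s × Branch x t z
  branch-split {t} {s} w with last-visit t w
  ... | inj₁ eq = inj₁ eq
  ... | inj₂ (inj₁ (t≢t , _)) = ⊥-elim (t≢t refl)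
  ... | inj₂ (inj₂ (x , e , w′)) = let (e′ , neq , _) = removeEdge-elim T e in
    inj₂ (x , e′ , (λ eq → neq (refl , eq)) , avoid⇒branch (removeEdge T t s) (proj₁ ∘ removeEdge-elim T) w′)

  tree-split : ∀ t z → z ≡ t ⊎ ∃ λ x → T t x ≡ true × Branch x t z
  tree-split t z with last-visit t (connected t z)
  ... | inj₁ eq = inj₁ eq
  ... | inj₂ (inj₁ (t≢t , _)) = ⊥-elim (t≢t refl)
  ... | inj₂ (inj₂ (x , e , w)) = inj₂ (x , e , avoid⇒branch T id w)

  -- By `root∉branch` the walk from `x` never returns to `t`, so it cannot use the edge between `t`
  -- and `s`.
  subbranch : ∀ {t s x z} → T t x ≡ true → x ≢ s → Branch x t z → Branch t s z
  subbranch {t} {s} {x} e x≢s w =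
    step (removeEdge-intro T e (x≢s ∘ proj₂) λ (t≡s , x≡t) → x≢s (trans x≡t t≡s))
      (walk-map (λ a b e′ → let (e″ , a≢t , b≢t) = avoid-elim (removeEdge T x t) e′ in
          removeEdge-intro T (proj₁ (removeEdge-elim T e″)) (a≢t ∘ proj₁) (b≢t ∘ proj₂))
        (unreachable⇒avoid (λ { w′ refl → root∉branch (trans (symm x t) e) w′ }) w))

-- Twisted chain graphs force large rank-width

-- Adjacency inside the grid and among the probes is left free, so that each host can fill it in its
-- own way.
TwistedChain : ∀ {N} → Graph N → (Fin N → Bool) → ℕ → Set
TwistedChain {N} G U n =
  Σ (Fin n → Fin N) λ a → Σ (Fin n → Fin N) λ b → Σ (Fin n → Fin n → Fin N) λ c →
    RowProbes G U a c × RowProbes G U b (flip c) ×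
    (∀ {i j i′ j′} → c i j ≡ c i′ j′ → i ≡ i′ × j ≡ j′)

-- The descent uses the full column when `β` is `true` and the unmixed rows when `β` is `false`.
Polar : ∀ {n} → (Fin n → Fin n → Bool) → Bool → Set
Polar Q β = (∃ λ j → ∀ i → Q i j ≡ β) × (∀ i → mixed Q i ≡ false → ∀ j → Q i j ≡ β)

-- An unmixed row and an unmixed column share a cell, whose value spreads along the column and from
-- there along each unmixed row.
polarize : ∀ {n} (Q : Fin n → Fin n → Bool) →
  countB (mixed Q) < n → countB (mixed (flip Q)) < n → ∃ (Polar Q)
polarize Q rows cols with countB<⇒∃false _ rows | countB<⇒∃false _ cols
... | i , i-const | j , j-const = Q i j ,
  (j , λ i′ → unmixed⇒constant (flip Q) j-const i′ i) ,
  λ i′ i′-const j′ → trans (unmixed⇒constant Q i′-const j′ j) (unmixed⇒constant (flip Q) j-const i′ i)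

-- `3 * (k + k)` bounds the rows mixed for some edge at a tree vertex; `2 + n₂` provides two
-- different rows and columns.
module _ {N n₂} {G : Graph N} {U : Fin N → Bool} {k} (large : 3 * (k + k) < 2 + n₂)
  (chain : TwistedChain G U (2 + n₂)) (decomposition : RankDecompositionOfWidth G U k) where

  open RankDecompositionOfWidth decomposition

  private
    n = 2 + n₂
    a = proj₁ chain
    b = proj₁ (proj₂ chain)
    c = proj₁ (proj₂ (proj₂ chain))
    rows = proj₁ (proj₂ (proj₂ (proj₂ chain)))
    cols = proj₁ (proj₂ (proj₂ (proj₂ (proj₂ chain))))
    c-inj = proj₂ (proj₂ (proj₂ (proj₂ (proj₂ chain))))
    c∈U : ∀ i j → Mem U (c i j)
    c∈U = proj₁ (proj₂ rows)

    T-sym : ∀ {u v} → T u v ≡ true → T v u ≡ true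
    T-sym {u} {v} = trans (IsTree.symm isTree v u)

  abstract
    -- The factor `U` makes this the cut of `width` verbatim, read on the grid.
    cut : Fin m → Fin m → Fin n → Fin n → Bool
    cut u v i j = U (c i j) ∧ side u v (leaf (c i j))

    cut⇒branch : ∀ {u v i j} → cut u v i j ≡ true → Branch isTree u v (leaf (c i j))
    cut⇒branch {i = i} {j} eq rewrite c∈U i j = proj₁ (side-spec _ _ _) eq

    branch⇒cut : ∀ {u v i j} → Branch isTree u v (leaf (c i j)) → cut u v i j ≡ true
    branch⇒cut {i = i} {j} w rewrite c∈U i j = proj₂ (side-spec _ _ _) w

    mixed-rows : ∀ {u v} → T u v ≡ true → countB (mixed (cut u v)) ≤ k + k
    mixed-rows e = mixed≤2*rank G U _ a c rows (width _ _ e)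

    mixed-cols : ∀ {u v} → T u v ≡ true → countB (mixed (flip (cut u v))) ≤ k + k
    mixed-cols e = mixed≤2*rank G U _ b (flip c) cols (width _ _ e)

  k+k<n : k + k < n
  k+k<n = ≤-<-trans (m≤m+n (k + k) _) large

  abstract
    cut-polar : ∀ {u v} → T u v ≡ true → ∃ (Polar (cut u v))
    cut-polar e = polarize _ (≤-<-trans (mixed-rows e) k+k<n) (≤-<-trans (mixed-cols e) k+k<n)

  degree≤3 : ∀ t → degree T t ≤ 3
  degree≤3 t with degrees t
  ... | inj₁ eq = ≤-trans (≤-reflexive eq) (s≤s z≤n)
  ... | inj₂ eq = ≤-reflexive eq

  leaf-neighbour-unique : ∀ {t x y} → degree T t ≡ 1 → T t x ≡ true → T t y ≡ true → x ≡ y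
  leaf-neighbour-unique eq = countB≤1⇒unique _ (≤-reflexive eq) _ _

  leaf-c-inj : ∀ {i j i′ j′} → leaf (c i j) ≡ leaf (c i′ j′) → i ≡ i′ × j ≡ j′
  leaf-c-inj eq = c-inj (leaf-inj _ _ (c∈U _ _) (c∈U _ _) eq)

  -- The measure of the descent; it drops strictly since `t` lies in its own branch but not in that
  -- of `x`.
  subbranch-< : ∀ {t s x} → T t x ≡ true → x ≢ s → countB (side x t) < countB (side t s)
  subbranch-< {t} {s} {x} e x≢s = countB-mono-< (side x t) (side t s)
    (λ z eq → proj₂ (side-spec t s z) (subbranch isTree e x≢s (proj₁ (side-spec x t z) eq)))
    t (¬-not (root∉branch isTree (T-sym e) ∘ proj₁ (side-spec x t t)))
    (proj₂ (side-spec t s t) here)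

  heavy-or-light : ∀ {u v} → T u v ≡ true →
    Polar (cut u v) true ⊎ (∀ i → mixed (cut u v) i ≡ false → ∀ j → cut u v i j ≡ false)
  heavy-or-light e with cut-polar e
  ... | true  , polar     = inj₁ polar
  ... | false , _ , light = inj₂ light

  -- By `branch-split` the leaf is `t` or lies in a further branch, and the latter contradicts
  -- lightness.
  placed-at : ∀ {t s i j} → cut t s i j ≡ true →
    (∀ x → T t x ≡ true → x ≢ s → cut x t i j ≡ false) → leaf (c i j) ≡ t
  placed-at inside light = [ id , (λ (x , e′ , x≢s , w) →
    ⊥-elim (false≢true (trans (sym (light x e′ x≢s)) (branch⇒cut w)))) ]′
    (branch-split isTree (cut⇒branch inside))

  -- Otherwise `t` is a leaf of the tree with sole neighbour `s`, so its branch is a single vertex,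
  -- which would also carry the vertex of another row.
  no-column-at : ∀ {t s j} i → T t s ≡ true → (∀ i → cut t s i j ≡ true) → ¬ leaf (c i j) ≡ t
  no-column-at {t} {s} {j} i e col at-t = let i′ , i′≢i = other i in
    i′≢i (proj₁ (leaf-c-inj (trans
      (placed-at (col i′) (λ x e′ x≢s → ⊥-elim (x≢s (leaf-neighbour-unique t-leaf e′ e))))
      (sym at-t))))
    where
    t-leaf : degree T t ≡ 1
    t-leaf = subst (λ r → degree T r ≡ 1) at-t (leaf-is-leaf _ (c∈U i j))
    other : ∀ (i : Fin n) → ∃ λ i′ → i′ ≢ i
    other zero    = suc zero , λ ()
    other (suc i) = zero , λ ()

  abstract
    -- At most three edges meet at `t`, and each spoils at most `k + k` rows.
    unmixed-row : ∀ t → ∃ λ i → ∀ x → T t x ≡ true → mixed (cut x t) i ≡ false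
    unmixed-row t =
      let bad , few , good = countB-⋃ (T t) (λ x → mixed (cut x t)) (k + k) (λ x → mixed-rows ∘ T-sym)
          i , i-good = countB<⇒∃false bad (≤-<-trans (≤-trans few (*-monoˡ-≤ (k + k) (degree≤3 t))) large)
      in i , good i i-good

  -- A column inside the branch meets a row that is unmixed for every edge at t. If all the
  -- subbranches were light, the leaf of their common vertex would be t itself.
  no-heavy-branch : ∀ fuel {t s} → T t s ≡ true → Polar (cut t s) true → countB (side t s) < fuel → ⊥
  no-heavy-branch (suc fuel) {t} {s} e ((j , col) , _) bound = no-column-at i e col
    (placed-at (col i) λ x e′ x≢s → [ (λ polar → ⊥-elim (no-heavy-branch fuel (T-sym e′) polar
       (<-≤-trans (subbranch-< e′ x≢s) (s≤s⁻¹ bound)))) , (λ light → light i (i-good x e′) j) ]′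
       (heavy-or-light (T-sym e′)))
    where
    i = proj₁ (unmixed-row t)
    i-good = proj₂ (unmixed-row t)

  -- The start is the leaf `t₀` of a grid vertex. If the branch of its neighbour `x₀` is heavy, the
  -- descent applies; if it is light, an unmixed row lies entirely at `t₀`.
  twistedChain⇒¬decomposition : ⊥
  -- `≤-refl` sets the fuel to one more than the size of the branch.
  twistedChain⇒¬decomposition = [ (λ polar → no-heavy-branch _ (T-sym t₀-x₀) polar ≤-refl) , all-light ]′
    (heavy-or-light (T-sym t₀-x₀))
    where
    t₀ = leaf (c zero zero)
    t₀-leaf : degree T t₀ ≡ 1
    t₀-leaf = leaf-is-leaf _ (c∈U zero zero)
    neighbour : ∃ λ x → T t₀ x ≡ true
    neighbour = let e , hit , _ = enumerate (T t₀) (≤-reflexive (sym t₀-leaf)) in e zero , hit zero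
    x₀ = proj₁ neighbour
    t₀-x₀ = proj₂ neighbour
    zero≢one : ∀ {l} → ¬ _≡_ {A = Fin (2 + l)} zero (suc zero)
    zero≢one ()
    i = proj₁ (unmixed-row t₀)
    all-light : ¬ (∀ i → mixed (cut x₀ t₀) i ≡ false → ∀ j → cut x₀ t₀ i j ≡ false)
    all-light light = zero≢one (proj₂ (leaf-c-inj (trans (at-t₀ zero) (sym (at-t₀ (suc zero))))))
      where
      at-t₀ : ∀ j → leaf (c i j) ≡ t₀
      at-t₀ j = [ id , (λ (x , e , w) → ⊥-elim (false≢true (trans
          (sym (light i (proj₂ (unmixed-row t₀) x₀ t₀-x₀) j))
          (branch⇒cut (subst (λ x → Branch isTree x t₀ _) (leaf-neighbour-unique t₀-leaf e t₀-x₀) w))))) ]′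
        (tree-split isTree t₀ (leaf (c i j)))

twistedChain⇒¬rankWidthAtMost : ∀ {N n₂} {G : Graph N} {U : Fin N → Bool} {k} →
  3 * (k + k) < 2 + n₂ → TwistedChain G U (2 + n₂) → ¬ RankWidthAtMost G U k
twistedChain⇒¬rankWidthAtMost large chain (inj₂ decomposition) = twistedChain⇒¬decomposition large chain decomposition
-- Two grid vertices from different rows rule out a set of size at most one.
twistedChain⇒¬rankWidthAtMost _ (_ , _ , c , (_ , c∈U , _) , _ , c-inj) (inj₁ few)
  with () ← proj₁ (c-inj (countB≤1⇒unique _ few (c zero zero) (c (suc zero) zero) (c∈U _ _) (c∈U _ _)))

-- Natural numbers as rational endpoints

-- Written in lowest terms with denominator 1 (stored as `0`), so that an inequality unfolds to one
-- between integers multiplied by one.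
ℕ→ℚ : ℕ → ℚ
ℕ→ℚ n = mkℚ (+ n) 0 (coprime-sym (1-coprimeTo n))

ℕ→ℚ-mono-≤ : ∀ {m n} → m ≤ n → ℕ→ℚ m ℚ.≤ ℕ→ℚ n
ℕ→ℚ-mono-≤ m≤n = *≤* (subst₂ ℤ._≤_ (sym (*-identityʳ _)) (sym (*-identityʳ _)) (+≤+ m≤n))

ℕ→ℚ-cancel-≤ : ∀ {m n} → ℕ→ℚ m ℚ.≤ ℕ→ℚ n → m ≤ n
ℕ→ℚ-cancel-≤ le = drop‿+≤+ (subst₂ ℤ._≤_ (*-identityʳ _) (*-identityʳ _) (drop-*≤* le))

ℕ→ℚ-mono-< : ∀ {m n} → m < n → ℕ→ℚ m ℚ.< ℕ→ℚ n
ℕ→ℚ-mono-< m<n = *<* (subst₂ ℤ._<_ (sym (*-identityʳ _)) (sym (*-identityʳ _)) (+<+ m<n))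

ℕ→ℚ-cancel-< : ∀ {m n} → ℕ→ℚ m ℚ.< ℕ→ℚ n → m < n
ℕ→ℚ-cancel-< lt = drop‿+<+ (subst₂ ℤ._<_ (*-identityʳ _) (*-identityʳ _) (drop-*<* lt))

-- The interval host and the permutation host

module _ {n} {R : Fin n → Fin n → Set} (R? : ∀ u v → Dec (R u v)) (R-sym : ∀ {u v} → R u v → R v u) where

  -- `Overlap` and `Crossing` are reflexive, hence the explicit mask on the diagonal.
  relationGraph : Graph n
  relationGraph = record
    { adj    = λ u v → not (does (u ≟ v)) ∧ does (R? u v)
    ; sym    = λ u v → cong₂ (λ x y → not x ∧ y)
                 (does-⇔ (mk⇔ sym sym) (u ≟ v) (v ≟ u)) (does-⇔ (mk⇔ R-sym R-sym) (R? u v) (R? v u))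
    ; irrefl = λ u → cong (λ x → not x ∧ does (R? u u)) (dec-true (u ≟ u) refl)
    }

  relationGraph-does : ∀ {u v} → u ≢ v → adj relationGraph u v ≡ does (R? u v)
  relationGraph-does {u} {v} u≢v = cong (λ x → not x ∧ does (R? u v)) (dec-false (u ≟ v) u≢v)

  adj⇒R : ∀ {u v} → u ≢ v → adj relationGraph u v ≡ true → R u v
  adj⇒R u≢v eq = does⇒ (R? _ _) (trans (sym (relationGraph-does u≢v)) eq)

  R⇒adj : ∀ {u v} → u ≢ v → R u v → adj relationGraph u v ≡ true
  R⇒adj u≢v r = trans (relationGraph-does u≢v) (dec-true (R? _ _) r)

module _ (M : ℕ) where

  -- The maximum keeps the interval nonempty for a decreasing pair as well; for an increasing pair
  -- `end` is `right`.
  left right end : Fin (M * M) → ℕ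
  left v  = toℕ (proj₁ (remQuot {M} M v))
  right v = toℕ (proj₂ (remQuot {M} M v))
  end v   = left v ⊔ right v

  Overlap : Fin (M * M) → Fin (M * M) → Set
  Overlap u v = left u ≤ end v × left v ≤ end u

  overlap? : ∀ u v → Dec (Overlap u v)
  overlap? u v = (left u ≤? end v) ×-dec (left v ≤? end u)

  overlap-sym : ∀ {u v} → Overlap u v → Overlap v u
  overlap-sym (p , q) = q , p

  intervalGraph : Graph (M * M)
  intervalGraph = relationGraph overlap? overlap-sym

  intervalGraph-isInterval : IsIntervalGraph intervalGraph
  intervalGraph-isInterval =
    ℕ→ℚ ∘ left , ℕ→ℚ ∘ end , (λ v → ℕ→ℚ-mono-≤ (m≤m⊔n (left v) (right v))) , λ u v u≢v →
    (λ eq → let p , q = adj⇒R overlap? overlap-sym u≢v eq in ℕ→ℚ-mono-≤ p , ℕ→ℚ-mono-≤ q) ,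
    (λ (p , q) → R⇒adj overlap? overlap-sym u≢v (ℕ→ℚ-cancel-≤ p , ℕ→ℚ-cancel-≤ q))

  Below : Fin (M * M) → Fin (M * M) → Set
  Below u v = left u < left v × right u < right v

  Crossing : Fin (M * M) → Fin (M * M) → Set
  Crossing u v = ¬ (Below u v ⊎ Below v u)

  below? : ∀ u v → Dec (Below u v)
  below? u v = (left u <? left v) ×-dec (right u <? right v)

  crossing? : ∀ u v → Dec (Crossing u v)
  crossing? u v = ¬? (below? u v ⊎-dec below? v u)

  crossing-sym : ∀ {u v} → Crossing u v → Crossing v u
  crossing-sym cross = cross ∘ swap

  permutationGraph : Graph (M * M)
  permutationGraph = relationGraph crossing? crossing-sym

  permutationGraph-isPermutation : IsPermutationGraph permutationGraph
  permutationGraph-isPermutation = ℕ→ℚ ∘ left , ℕ→ℚ ∘ right , λ u v u≢v →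
    (λ eq → adj⇒R crossing? crossing-sym u≢v eq ∘ Sum.map
      (λ (p , q) → ℕ→ℚ-cancel-< p , ℕ→ℚ-cancel-< q) (λ (p , q) → ℕ→ℚ-cancel-< p , ℕ→ℚ-cancel-< q)) ,
    (λ meet → R⇒adj crossing? crossing-sym u≢v (meet ∘ Sum.map
      (λ (p , q) → ℕ→ℚ-mono-< p , ℕ→ℚ-mono-< q) (λ (p , q) → ℕ→ℚ-mono-< p , ℕ→ℚ-mono-< q)))

-- Twisted chains from a homogeneous set

-- In increasing order: `lowest`, the block `lower`, `middle`, the block `upper`, `highest`. Grid
-- vertices pair `lower` with `upper`; the three single positions serve as free ends of probes.
positions : ℕ → ℕ
positions n = 1 + (n + (1 + (n + 1)))

module Positions (n : ℕ) where

  lowest : Fin (positions n)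
  lowest = zero

  lower : Fin n → Fin (positions n)
  lower i = suc (i ↑ˡ _)

  middle : Fin (positions n)
  middle = suc (n ↑ʳ zero)

  upper : Fin n → Fin (positions n)
  upper j = suc (n ↑ʳ suc (j ↑ˡ 1))

  highest : Fin (positions n)
  highest = suc (n ↑ʳ suc (n ↑ʳ zero))

  lowest<lower : ∀ i → lowest Fin.< lower i
  lowest<lower i = s≤s z≤n

  lower-mono : ∀ {i j} → i Fin.< j → lower i Fin.< lower j
  lower-mono {i} {j} lt = s≤s (subst₂ _<_ (sym (toℕ-↑ˡ i _)) (sym (toℕ-↑ˡ j _)) lt)

  lower<middle : ∀ i → lower i Fin.< middle
  lower<middle i = s≤s (subst₂ _<_ (sym (toℕ-↑ˡ i _)) (sym (toℕ-↑ʳ n _)) (<-≤-trans (toℕ<n i) (m≤m+n n 0)))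

  ↑ʳ-mono : ∀ {l} k {i j : Fin l} → i Fin.< j → k ↑ʳ i Fin.< k ↑ʳ j
  ↑ʳ-mono k {i} {j} lt = subst₂ _<_ (sym (toℕ-↑ʳ k i)) (sym (toℕ-↑ʳ k j)) (+-monoʳ-< k lt)

  middle<upper : ∀ j → middle Fin.< upper j
  middle<upper j = s≤s (↑ʳ-mono n (s≤s z≤n))

  upper-mono : ∀ {i j} → i Fin.< j → upper i Fin.< upper j
  upper-mono {i} {j} lt = s≤s (↑ʳ-mono n (s≤s (subst₂ _<_ (sym (toℕ-↑ˡ i _)) (sym (toℕ-↑ˡ j _)) lt)))

  upper<highest : ∀ j → upper j Fin.< highest
  upper<highest j = s≤s (↑ʳ-mono n (s≤s
    (subst₂ _<_ (sym (toℕ-↑ˡ j _)) (sym (toℕ-↑ʳ n _)) (<-≤-trans (toℕ<n j) (m≤m+n n 0)))))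

module _ {n : ℕ} (f : Fin n → ℕ) (mono : ∀ {i j} → i Fin.< j → f i < f j) where

  mono-≤ : ∀ {i j} → i Fin.≤ j → f i ≤ f j
  mono-≤ {i} {j} le with m≤n⇒m<n∨m≡n le
  ... | inj₁ lt = <⇒≤ (mono lt)
  ... | inj₂ eq = ≤-reflexive (cong f (toℕ-injective eq))

  cancel-≤ : ∀ {i j} → f i ≤ f j → i Fin.≤ j
  cancel-≤ le = ≮⇒≥ λ lt → <⇒≱ (mono lt) le

  cancel-≡ : ∀ {i j} → f i ≡ f j → i ≡ j
  cancel-≡ eq = toℕ-injective (≤-antisym (cancel-≤ (≤-reflexive eq)) (cancel-≤ (≤-reflexive (sym eq))))

opposite-≤ : ∀ {n} {i j : Fin n} → i Fin.≤ j → opposite j Fin.≤ opposite i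
opposite-≤ {n} {i} {j} le = subst₂ _≤_ (sym (opposite-prop j)) (sym (opposite-prop i)) (∸-monoʳ-≤ n (s≤s le))

opposite-≤⁻ : ∀ {n} {i j : Fin n} → opposite j Fin.≤ opposite i → i Fin.≤ j
opposite-≤⁻ {i = i} {j} le = subst₂ Fin._≤_ (opposite-involutive i) (opposite-involutive j) (opposite-≤ le)

module _ {n M} (U : Fin (M * M) → Bool) (h : Fin (positions n) → Fin M)
  (h-mono : ∀ {i j} → i Fin.< j → h i Fin.< h j)
  (h∈U : ∀ {i j} → i Fin.< j → Mem U (combine (h i) (h j))) where

  open Positions n

  private
    H : Fin (positions n) → ℕ
    H = toℕ ∘ h

    vertex : Fin (positions n) → Fin (positions n) → Fin (M * M)
    vertex p q = combine (h p) (h q)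

    H-cancel : ∀ {p q} → H p ≡ H q → p ≡ q
    H-cancel = cancel-≡ H h-mono

    vertex-inj : ∀ {p q p′ q′} → vertex p q ≡ vertex p′ q′ → p ≡ p′ × q ≡ q′
    vertex-inj eq = let e₁ , e₂ = combine-injective (h _) (h _) (h _) (h _) eq in
      H-cancel (cong toℕ e₁) , H-cancel (cong toℕ e₂)

    left-vertex : ∀ {p q} → left M (vertex p q) ≡ H p
    left-vertex {p} {q} = cong (toℕ ∘ proj₁) (remQuot-combine (h p) (h q))

    right-vertex : ∀ {p q} → right M (vertex p q) ≡ H q
    right-vertex {p} {q} = cong (toℕ ∘ proj₂) (remQuot-combine (h p) (h q))

    end-vertex : ∀ {p q} → p Fin.< q → end M (vertex p q) ≡ H q
    end-vertex p<q = trans (cong₂ ℕ._⊔_ left-vertex right-vertex) (m≤n⇒m⊔n≡n (<⇒≤ (h-mono p<q)))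

    lower<upper : ∀ i j → lower i Fin.< upper j
    lower<upper i j = <-trans (lower<middle i) (middle<upper j)

    L R : Fin n → ℕ
    L = H ∘ lower
    R = H ∘ upper

    L-mono : ∀ {i j} → i Fin.< j → L i < L j
    L-mono = h-mono ∘ lower-mono
    R-mono : ∀ {i j} → i Fin.< j → R i < R j
    R-mono = h-mono ∘ upper-mono

    overlap-vertex : ∀ {p q p′ q′} → p Fin.< q → p′ Fin.< q′ →
      Overlap M (vertex p q) (vertex p′ q′) ≡ (H p ≤ H q′ × H p′ ≤ H q)
    overlap-vertex lt lt′ = cong₂ _×_ (cong₂ _≤_ left-vertex (end-vertex lt′)) (cong₂ _≤_ left-vertex (end-vertex lt))

    below-vertex : ∀ {p q p′ q′} → Below M (vertex p q) (vertex p′ q′) ≡ (H p < H p′ × H q < H q′)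
    below-vertex = cong₂ _×_ (cong₂ _<_ left-vertex left-vertex) (cong₂ _<_ right-vertex right-vertex)

    interval-adj : ∀ {p q p′ q′} {P : Set} (P? : Dec P) → p Fin.< q → p′ Fin.< q′ → p ≢ p′ →
      (H p ≤ H q′ × H p′ ≤ H q) ⇔ P → adj (intervalGraph M) (vertex p q) (vertex p′ q′) ≡ does P?
    interval-adj {P = P} P? lt lt′ neq iff =
      trans (relationGraph-does (overlap? M) (overlap-sym M) (neq ∘ proj₁ ∘ vertex-inj))
        (does-⇔ (subst (_⇔ P) (sym (overlap-vertex lt lt′)) iff) (overlap? M _ _) P?)

    crossing-vertex : ∀ {p q p′ q′} → Crossing M (vertex p q) (vertex p′ q′) ≡
      (¬ ((H p < H p′ × H q < H q′) ⊎ (H p′ < H p × H q′ < H q)))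
    crossing-vertex = cong ¬_ (cong₂ _⊎_ below-vertex below-vertex)

    permutation-adj : ∀ {p q p′ q′} {P : Set} (P? : Dec P) → vertex p q ≢ vertex p′ q′ →
      (¬ ((H p < H p′ × H q < H q′) ⊎ (H p′ < H p × H q′ < H q))) ⇔ P →
      adj (permutationGraph M) (vertex p q) (vertex p′ q′) ≡ does P?
    permutation-adj {P = P} P? neq iff =
      trans (relationGraph-does (crossing? M) (crossing-sym M) neq)
        (does-⇔ (subst (_⇔ P) (sym crossing-vertex) iff) (crossing? M _ _) P?)

  -- Row indices are reversed: the probe [lowest , lower x] meets [lower i , _] iff i ≤ x.
  interval-twistedChain : TwistedChain (intervalGraph M) U n
  interval-twistedChain =
    (λ x → vertex lowest (lower (opposite x))) , (λ y → vertex (upper y) highest) ,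
    (λ i j → vertex (lower (opposite i)) (upper j)) ,
    ((λ x → h∈U (lowest<lower _)) , (λ i j → h∈U (lower<upper _ j)) , λ x i j →
      interval-adj (x Fin.≤? i) (lowest<lower _) (lower<upper _ j) (Fin.<⇒≢ (lowest<lower _))
        (mk⇔ (λ (_ , le) → opposite-≤⁻ (cancel-≤ L L-mono le))
             (λ le → <⇒≤ (h-mono (s≤s z≤n)) , mono-≤ L L-mono (opposite-≤ le)))) ,
    -- A column probe runs from `upper y` to `highest`, beyond all right ends of the grid, so only
    -- the comparison of `upper y` with `upper j` matters.
    ((λ y → h∈U (upper<highest y)) , (λ i j → h∈U (lower<upper _ i)) , λ y j i →
      interval-adj (y Fin.≤? j) (upper<highest y) (lower<upper _ j) (Fin.<⇒≢ (lower<upper _ y) ∘ sym)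
        (mk⇔ (λ (le , _) → cancel-≤ R R-mono le)
             (λ le → mono-≤ R R-mono le , <⇒≤ (h-mono (<-trans (lower<upper _ j) (upper<highest j)))))) ,
    λ {i} {j} {i′} {j′} eq → let e₁ , e₂ = vertex-inj eq in
      opposite-injective (cancel-≡ L L-mono (cong H e₁)) , cancel-≡ R R-mono (cong H e₂)
    where
    opposite-injective : ∀ {i j : Fin n} → opposite i ≡ opposite j → i ≡ j
    opposite-injective eq = toℕ-injective (≤-antisym
      (opposite-≤⁻ (≤-reflexive (cong toℕ (sym eq)))) (opposite-≤⁻ (≤-reflexive (cong toℕ eq))))

  -- A row probe ends at `highest`, above every grid segment on the second line, so it meets one iff
  -- it does not start strictly later on the first; a common endpoint counts as meeting. Column
  -- probes start at `middle` and use the two lines in exchanged roles.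
  permutation-twistedChain : TwistedChain (permutationGraph M) U n
  permutation-twistedChain =
    (λ x → vertex (lower x) highest) , (λ y → vertex middle (upper y)) ,
    (λ i j → vertex (lower i) (upper j)) ,
    ((λ x → h∈U (<-trans (lower<upper x x) (upper<highest x))) , (λ i j → h∈U (lower<upper i j)) , λ x i j →
      permutation-adj (x Fin.≤? i) (Fin.<⇒≢ (upper<highest j) ∘ sym ∘ proj₂ ∘ vertex-inj)
        (mk⇔ (λ cross → ≮⇒≥ λ lt → cross (inj₂ (L-mono lt , h-mono (upper<highest j))))
             (λ le → [ (λ (_ , lt) → <-asym lt (h-mono (upper<highest j))) ,
                       (λ (lt , _) → <⇒≱ lt (mono-≤ L L-mono le)) ]′))) ,
    ((λ y → h∈U (middle<upper y)) , (λ i j → h∈U (lower<upper j i)) , λ y j i →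
      permutation-adj (y Fin.≤? j) (Fin.<⇒≢ (lower<middle i) ∘ sym ∘ proj₁ ∘ vertex-inj)
        (mk⇔ (λ cross → ≮⇒≥ λ lt → cross (inj₂ (h-mono (lower<middle i) , R-mono lt)))
             (λ le → [ (λ (lt , _) → <-asym lt (h-mono (lower<middle i))) ,
                       (λ (_ , lt) → <⇒≱ lt (mono-≤ R R-mono le)) ]′))) ,
    λ eq → let e₁ , e₂ = vertex-inj eq in cancel-≡ L L-mono (cong H e₁) , cancel-≡ R R-mono (cong H e₂)

-- From Ramsey's theorem to the failure of every colouring

-- The contradiction arises at `p = 1`: `Q 1` fixes the grid size, `N 1` then fixes the host, and
-- the colour class of the homogeneous pairs contains a twisted chain too large for `Q 1`.
noLowRankWidthColorings : (D : GraphClass) (G : ∀ M → Graph (M * M)) → (∀ M → D (G M)) →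
  (∀ {n M} (U : Fin (M * M) → Bool) (h : Fin (positions n) → Fin M) →
    (∀ {i j} → i Fin.< j → h i Fin.< h j) →
    (∀ {i j} → i Fin.< j → Mem U (combine (h i) (h j))) → TwistedChain (G M) U n) →
  ¬ AdmitsLowRankWidthColorings D
noLowRankWidthColorings D G G∈D chain (N , Q , colouring) =
  twistedChain⇒¬rankWidthAtMost (s≤s (n≤1+n n₂))
    (chain U h (proj₁ ∘ mono) λ i<j → dec-true (col _ ≟ d) (proj₂ (mono i<j)))
    -- The chosen set of colours is the singleton of `d`.
    (proj₂ coloured 1 ≤-refl (λ e → does (e ≟ d)) (countB-single d))
  where
  n₂ = 3 * (Q 1 + Q 1)
  M = ramseyBound {N 1} (positions (2 + n₂))
  coloured = colouring 1 (G M) (G∈D M)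
  col = proj₁ coloured
  -- A pair gets the colour of the vertex that encodes it.
  mono-subset = ramsey (positions (2 + n₂)) (λ i j → col (combine i j))
  d = proj₁ mono-subset
  h = proj₁ (proj₂ mono-subset)
  mono = proj₂ (proj₂ mono-subset)
  U : Fin (M * M) → Bool
  U v = does (col v ≟ d)

theorem7 : ¬ AdmitsLowRankWidthColorings IsIntervalGraph × ¬ AdmitsLowRankWidthColorings IsPermutationGraph
theorem7 =
  noLowRankWidthColorings IsIntervalGraph intervalGraph intervalGraph-isInterval interval-twistedChain ,
  noLowRankWidthColorings IsPermutationGraph permutationGraph permutationGraph-isPermutation permutation-twistedChain
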